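{- For any non-negative integers $v,h$ and any integer $a$, the set $$\mathbb{B}_{v+1,h+1,a}:=\{\sigma(\mathbf{x})\mid\mathbf{x}\in\mathbb{Y}_{v+1,h+1,a}\}$$ is perfect for balanced adjacent deletions; that is, for different $\mathbf{c},\mathbf{c}'\in\mathbb{B}_{v+1,h+1,a}$ one has $\mathrm{dS}(\mathbf{c})\cap\mathrm{dS}(\mathbf{c}')=\emptyset$, and $\bigcup_{\mathbf{c}\in\mathbb{B}_{v+1,h+1,a}}\mathrm{dS}(\mathbf{c})=\mathbb{Y}_{v,h}$.
   Context: $\mathbb{Y}_{v,h}$ is the set of bit sequences in $\{0,1\}^{v+h}$ with exactly $v$ zeros and $h$ ones. For a bit sequence $\mathbf{x}$, $\mathrm{inv}(\mathbf{x})=\#\{(i,j)\mid i<j,\ x_i>x_j\}$. $\mathbb{Y}_{v,h,a}:=\{\mathbf{x}\in\mathbb{Y}_{v,h}\mid\mathrm{inv}(\mathbf{x})\equiv a\pmod{v+h}\}$ (so for $\mathbb{Y}_{v+1,h+1,a}$ the modulus is $v+h+2$). The azby permutation is $\sigma(x_1x_2x_3\cdots x_{n-1}x_n):=x_1x_nx_2x_{n-1}x_3\cdots$. A balanced adjacent deletion (BAD) deletes two adjacent bits of a sequence that form a subword $01$ or $10$. For a bit sequence $\mathbf{c}$, $\mathrm{dS}(\mathbf{c})$ is the set of all sequences obtained from $\mathbf{c}$ by a single BAD. -}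

module Defs where

open import Data.Fin using (Fin; _<_; _>_; _<?_; _≟_)
open import Data.Fin.Patterns using (0F; 1F)
open import Data.Integer using (ℤ; +_; _-_)
open import Data.Integer.Divisibility.Signed using (_∣_)
open import Data.List using (List; []; _∷_; _++_; length; lookup; take; reverse; filter; allFin; cartesianProduct)
open import Data.Nat using (ℕ; _+_)
open import Data.Product using (_×_; _,_; ∃-syntax)
open import Data.Sum using (_⊎_)
open import Level using (0ℓ)
open import Relation.Binary.PropositionalEquality using (_≡_)
open import Relation.Nullary using (Dec; _×-dec_)
open import Relation.Unary using (Pred; _∈_)

Bit : Set
Bit = Fin 2

-- Sequences are lists rather than vectors, so that sequences of length
-- (v + 1) + (h + 1) and v + h can be related without transporting along
-- equalities of lengths.
BitSeq : Set
BitSeq = List Bit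

occurrences : Bit → BitSeq → ℕ
occurrences b x = length (filter (_≟ b) x)

-- Membership of {0,1}^(v+h) is kept as an explicit conjunct.
𝕐 : ℕ → ℕ → Pred BitSeq 0ℓ
𝕐 v h x = length x ≡ v + h × occurrences 0F x ≡ v × occurrences 1F x ≡ h

IsInversion : (x : BitSeq) → Pred (Fin (length x) × Fin (length x)) 0ℓ
IsInversion x (i , j) = i < j × lookup x i > lookup x j

isInversion? : ∀ x ij → Dec (IsInversion x ij)
isInversion? x (i , j) = (i <? j) ×-dec (lookup x j <? lookup x i)

inv : BitSeq → ℕ
inv x = length (filter (isInversion? x)
                       (cartesianProduct (allFin (length x)) (allFin (length x))))

_≡_[mod_] : ℤ → ℤ → ℕ → Set
a ≡ b [mod n ] = + n ∣ a - b

𝕐ₐ : ℕ → ℕ → ℤ → Pred BitSeq 0ℓ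
𝕐ₐ v h a x = x ∈ 𝕐 v h × (+ inv x) ≡ a [mod v + h ]

interleave : {A : Set} → List A → List A → List A
interleave []       ys = ys
interleave (x ∷ xs) ys = x ∷ interleave ys xs

-- Interleaving x₁ x₂ … xₙ with xₙ xₙ₋₁ … x₁ gives x₁ xₙ x₂ xₙ₋₁ …, in which
-- the first n entries use every index exactly once.
σ : {A : Set} → List A → List A
σ x = take (length x) (interleave x (reverse x))

_ : σ (1 ∷ 2 ∷ 3 ∷ 4 ∷ 5 ∷ []) ≡ 1 ∷ 5 ∷ 2 ∷ 4 ∷ 3 ∷ []
_ = _≡_.refl

_ : σ (1 ∷ 2 ∷ 3 ∷ 4 ∷ 5 ∷ 6 ∷ []) ≡ 1 ∷ 6 ∷ 2 ∷ 5 ∷ 3 ∷ 4 ∷ []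
_ = _≡_.refl

𝔹 : ℕ → ℕ → ℤ → Pred BitSeq 0ℓ
𝔹 v h a c = ∃[ x ] x ∈ 𝕐ₐ v h a × c ≡ σ x

dS : BitSeq → Pred BitSeq 0ℓ
dS c d = ∃[ p ] ∃[ q ] (c ≡ p ++ 0F ∷ 1F ∷ q ⊎ c ≡ p ++ 1F ∷ 0F ∷ q) × d ≡ p ++ q

{-# OPTIONS --safe #-}

-- If c = σ x, a balanced adjacent deletion in c removes from x a 0 and a 1 at
-- symmetric positions, up to a shift by one. Undoing it, i.e. inserting a
-- balanced pair into d, raises inv x by some t ≤ |d| + 1. As the insertion
-- point slides along d, the insertions that put the 0 to the left of the 1 in x
-- take the values 0, …, f and the others f + 1, …, |d| + 1, and all insertions
-- with the same t give the same c. Since |d| + 2 is the modulus, each residue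
-- class contains exactly one c over each d.
module Submission where

open import Defs
open import Algebra.Properties.CommutativeSemigroup using (x∙yz≈y∙xz)
open import Data.Bool using (if_then_else_)
open import Data.Fin using (Fin; opposite; toℕ; _≟_; zero; suc)
open import Data.Fin.Patterns using (0F; 1F)
open import Data.Integer using (ℤ; +_; _-_; ∣_∣)
import Data.Integer as ℤ
open import Data.Integer.DivMod using (_%ℕ_; _/ℕ_; n%ℕd<d; a≡a%ℕn+[a/ℕn]*n)
open import Data.Integer.Divisibility.Signed using (_∣_; divides; ∣⇒∣ᵤ; ∣m∣n⇒∣m-n)
import Data.Integer.Properties as ℤₚ
import Data.Integer.Tactic.RingSolver as ℤ-Solver
open import Data.List using (List; []; _∷_; _++_; _∷ʳ_; length; lookup; take; reverse; filter; map; allFin; cartesianProduct)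
open import Data.List.Properties using (++-identityʳ; filter-++; length-++; length-reverse; map-tabulate; reverse-involutive; tabulate-lookup; unfold-reverse)
open import Data.List.Relation.Binary.Permutation.Propositional using (_↭_; ↭-refl; ↭-sym; ↭-trans; prep; swap)
open import Data.List.Relation.Binary.Permutation.Propositional.Properties using (filter-↭; shifts; ↭-length; ↭-reverse)
open import Data.Nat using (ℕ; suc; _+_; _≤_; _<_; z≤n; s≤s; s≤s⁻¹; >-nonZero)
import Data.Nat.Divisibility as ℕ
open import Data.Nat.Properties using (+-commutativeSemigroup; <-cmp; <⇒≤; <-irrefl; m<n⇒0<n∸m; m∸n≤m; m≤n⇒m≤1+n; m≤n⇒m<n∨m≡n; ≤-<-trans; ≤-refl; ≤-reflexive; +-assoc; +-identityʳ; +-suc; suc-injective)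
open import Data.Nat.Tactic.RingSolver using (solve-∀)
open import Data.Product using (Σ; _×_; _,_; proj₁; proj₂; ∃-syntax)
open import Data.Sum using (inj₁; inj₂)
open import Function using (_∘_; id; _⇔_; mk⇔; Equivalence)
open import Function.Properties.Equivalence using () renaming (refl to ⇔-refl)
open import Level using (0ℓ)
open import Relation.Binary using (tri<; tri≈; tri>)
open import Relation.Binary.PropositionalEquality using (_≡_; _≢_; refl; sym; trans; cong; cong₂; subst; module ≡-Reasoning)
open import Relation.Nullary using (does; yes; no; ¬_; contradiction)
open import Relation.Unary using (Pred; Decidable; _∈_; _∩_; _≐_; Empty; ⋃)

-- Counting statistics on bit sequences

charge : Bit → Bit → BitSeq → ℕ
charge s b x = if does (b ≟ s) then 0 else occurrences s x

-- The number of pairs i < j with xᵢ = opposite s and xⱼ = s; for s = 0F these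
-- are the inversions.
pairs : Bit → BitSeq → ℕ
pairs s []      = 0
pairs s (b ∷ x) = charge s b x + pairs s x

-- pairs s x for c = σ x: consuming c from the left consumes x alternately from
-- its left and right ends, and reversal exchanges the roles of the two bits.
zigzag : Bit → BitSeq → ℕ
zigzag s []      = 0
zigzag s (b ∷ c) = charge s b c + zigzag (opposite s) c

occurrences-++ : ∀ b x y → occurrences b (x ++ y) ≡ occurrences b x + occurrences b y
occurrences-++ b x y = trans (cong length (filter-++ (_≟ b) x y)) (length-++ (filter (_≟ b) x))

occurrences-↭ : ∀ b {x y} → x ↭ y → occurrences b x ≡ occurrences b y
occurrences-↭ b x↭y = ↭-length (filter-↭ (_≟ b) x↭y)

occurrences-total : ∀ s x → occurrences s x + occurrences (opposite s) x ≡ length x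
occurrences-total s  []       = refl
occurrences-total 0F (0F ∷ x) = cong suc (occurrences-total 0F x)
occurrences-total 0F (1F ∷ x) = trans (+-suc _ _) (cong suc (occurrences-total 0F x))
occurrences-total 1F (0F ∷ x) = trans (+-suc _ _) (cong suc (occurrences-total 1F x))
occurrences-total 1F (1F ∷ x) = cong suc (occurrences-total 1F x)

-- Inversions

length-filter-map : ∀ {A B : Set} {P : Pred B 0ℓ} {Q : Pred A 0ℓ} (P? : Decidable P) (Q? : Decidable Q)
  (f : A → B) → (∀ a → P (f a) ⇔ Q a) → ∀ xs →
  length (filter P? (map f xs)) ≡ length (filter Q? xs)
length-filter-map P? Q? f P⇔Q []       = refl
length-filter-map P? Q? f P⇔Q (x ∷ xs) with P? (f x) | Q? x
... | yes _ | yes _ = cong suc (length-filter-map P? Q? f P⇔Q xs)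
... | no  _ | no  _ = length-filter-map P? Q? f P⇔Q xs
... | yes p | no ¬q = contradiction (Equivalence.to (P⇔Q x) p) ¬q
... | no ¬p | yes q = contradiction (Equivalence.from (P⇔Q x) q) ¬p

length-filter-none : ∀ {A : Set} {P : Pred A 0ℓ} (P? : Decidable P) → (∀ a → ¬ P a) → ∀ xs →
  length (filter P? xs) ≡ 0
length-filter-none P? ¬P []       = refl
length-filter-none P? ¬P (x ∷ xs) with P? x
... | yes p = contradiction p (¬P x)
... | no  _ = length-filter-none P? ¬P xs

length-filter-++ : ∀ {A : Set} {P : Pred A 0ℓ} (P? : Decidable P) xs ys →
  length (filter P? (xs ++ ys)) ≡ length (filter P? xs) + length (filter P? ys)
length-filter-++ P? xs ys = trans (cong length (filter-++ P? xs ys)) (length-++ (filter P? xs))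

-- The column of `zero` contributes nothing, as no index lies below it. Keeping `is` and `js` as
-- separate lists lets the rows be consumed one at a time against a fixed set of columns.
inv-tail : ∀ b x (is js : List (Fin (length x))) →
  length (filter (isInversion? (b ∷ x)) (cartesianProduct (map suc is) (zero ∷ map suc js)))
    ≡ length (filter (isInversion? x) (cartesianProduct is js))
inv-tail b x []       js = refl
inv-tail b x (i ∷ is) js = begin
  -- The pair `(suc i , zero)` is already gone here: its decision computes to `no`.
  length (filter I′ (map (suc i ,_) (map suc js) ++ cartesianProduct (map suc is) (zero ∷ map suc js)))
    ≡⟨ length-filter-++ I′ (map (suc i ,_) (map suc js)) _ ⟩
  length (filter I′ (map (suc i ,_) (map suc js))) + _
    ≡⟨ cong₂ _+_ row (inv-tail b x is js) ⟩
  length (filter I (map (i ,_) js)) + length (filter I (cartesianProduct is js))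
    ≡⟨ length-filter-++ I (map (i ,_) js) _ ⟨
  length (filter I (map (i ,_) js ++ cartesianProduct is js)) ∎
  where
  open ≡-Reasoning
  I′ = isInversion? (b ∷ x)
  I  = isInversion? x
  row : length (filter I′ (map (suc i ,_) (map suc js))) ≡ length (filter I (map (i ,_) js))
  row = begin
    length (filter I′ (map (suc i ,_) (map suc js)))
      ≡⟨ length-filter-map I′ (I′ ∘ (suc i ,_)) (suc i ,_) (λ _ → ⇔-refl) (map suc js) ⟩
    length (filter (I′ ∘ (suc i ,_)) (map suc js))
      ≡⟨ length-filter-map (I′ ∘ (suc i ,_)) (I ∘ (i ,_)) suc
           (λ _ → mk⇔ (λ (p , q) → s≤s⁻¹ p , q) (λ (p , q) → s≤s p , q)) js ⟩
    length (filter (I ∘ (i ,_)) js)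
      ≡⟨ length-filter-map I (I ∘ (i ,_)) (i ,_) (λ _ → ⇔-refl) js ⟨
    length (filter I (map (i ,_) js)) ∎

-- A leading 0 exceeds no later bit, and a leading 1 exceeds exactly the later zeros.
inv-head : ∀ b x →
  length (filter (isInversion? (b ∷ x)) (map (zero ,_) (map suc (allFin (length x))))) ≡ charge 0F b x
inv-head 0F x = trans (length-filter-map I′ (I′ ∘ (zero ,_)) (zero ,_) (λ _ → ⇔-refl) js)
                      (length-filter-none (I′ ∘ (zero ,_)) (λ { _ (_ , ()) }) js)
  where
  I′ = isInversion? (0F ∷ x)
  js = map suc (allFin (length x))
inv-head 1F x = begin
  length (filter I′ (map (zero ,_) (map suc js)))
    ≡⟨ length-filter-map I′ (I′ ∘ (zero ,_)) (zero ,_) (λ _ → ⇔-refl) (map suc js) ⟩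
  length (filter (I′ ∘ (zero ,_)) (map suc js))
    ≡⟨ length-filter-map (I′ ∘ (zero ,_)) ((_≟ 0F) ∘ lookup x) suc
         (λ j → mk⇔ (λ (_ , p) → <1⇒≡0 _ p) (λ eq → s≤s z≤n , ≡0⇒<1 _ eq)) js ⟩
  length (filter ((_≟ 0F) ∘ lookup x) js)
    ≡⟨ length-filter-map (_≟ 0F) ((_≟ 0F) ∘ lookup x) (lookup x) (λ _ → ⇔-refl) js ⟨
  occurrences 0F (map (lookup x) js)
    ≡⟨ cong (occurrences 0F) (trans (map-tabulate id (lookup x)) (tabulate-lookup x)) ⟩
  occurrences 0F x ∎
  where
  open ≡-Reasoning
  I′ = isInversion? (1F ∷ x)
  js = allFin (length x)
  <1⇒≡0 : (b : Bit) → toℕ b < 1 → b ≡ 0F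
  <1⇒≡0 0F _         = refl
  <1⇒≡0 1F (s≤s ())
  ≡0⇒<1 : (b : Bit) → b ≡ 0F → toℕ b < 1
  ≡0⇒<1 _ refl = s≤s z≤n

inv≡pairs : ∀ x → inv x ≡ pairs 0F x
inv≡pairs []      = refl
inv≡pairs (b ∷ x) = begin
  inv (b ∷ x)
    -- `allFin` of a successor unfolds to `zero ∷ tabulate suc`; the tail must be a `map suc` for
    -- `inv-head` and `inv-tail` to apply.
    ≡⟨ cong (λ is → length (filter I′ (cartesianProduct (zero ∷ is) (zero ∷ is)))) (map-tabulate id suc) ⟨
  length (filter I′ (cartesianProduct (zero ∷ is) (zero ∷ is)))
    ≡⟨ length-filter-++ I′ (map (zero ,_) is) (cartesianProduct is (zero ∷ is)) ⟩
  length (filter I′ (map (zero ,_) is)) + length (filter I′ (cartesianProduct is (zero ∷ is)))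
    ≡⟨ cong₂ _+_ (inv-head b x) (inv-tail b x (allFin (length x)) (allFin (length x))) ⟩
  charge 0F b x + inv x
    ≡⟨ cong₂ _+_ refl (inv≡pairs x) ⟩
  pairs 0F (b ∷ x) ∎
  where
  open ≡-Reasoning
  I′ = isInversion? (b ∷ x)
  is = map suc (allFin (length x))

-- For `opposite s` the earlier bit of a pair is `s`, so a final `b` other than `s` closes one pair
-- with each `s` in `x`. This is the charge that `b` would incur in front of `x` for `s`, whence
-- `pairs-reverse`.
pairs-∷ʳ : ∀ s x b → pairs (opposite s) (x ∷ʳ b) ≡ charge s b x + pairs (opposite s) x
pairs-∷ʳ 0F []       0F = refl
pairs-∷ʳ 0F []       1F = refl
pairs-∷ʳ 1F []       0F = refl
pairs-∷ʳ 1F []       1F = refl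
pairs-∷ʳ s  (a ∷ x)  b  = begin
  charge (opposite s) a (x ∷ʳ b) + pairs (opposite s) (x ∷ʳ b)
    ≡⟨ cong₂ _+_ {charge (opposite s) a (x ∷ʳ b)} refl (pairs-∷ʳ s x b) ⟩
  charge (opposite s) a (x ∷ʳ b) + (charge s b x + pairs (opposite s) x)
    ≡⟨ +-assoc (charge (opposite s) a (x ∷ʳ b)) _ _ ⟨
  charge (opposite s) a (x ∷ʳ b) + charge s b x + pairs (opposite s) x
    -- The possible pair of the end bits `a` and `b` is charged to `a` on the left and to `b` on the
    -- right.
    ≡⟨ cong (_+ pairs (opposite s) x) (exchange s a b) ⟩
  charge s b (a ∷ x) + charge (opposite s) a x + pairs (opposite s) x
    ≡⟨ +-assoc (charge s b (a ∷ x)) _ _ ⟩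
  charge s b (a ∷ x) + pairs (opposite s) (a ∷ x) ∎
  where
  open ≡-Reasoning
  snoc = λ s b → occurrences-++ s x (b ∷ [])
  shuffle : ∀ m n → m + 1 + n ≡ suc n + m
  shuffle = solve-∀
  exchange : ∀ s a b → charge (opposite s) a (x ∷ʳ b) + charge s b x
                     ≡ charge s b (a ∷ x) + charge (opposite s) a x
  exchange 0F 0F 0F = trans (+-identityʳ _) (trans (snoc 1F 0F) (+-identityʳ _))
  exchange 0F 0F 1F = trans (cong (_+ occurrences 0F x) (snoc 1F 1F)) (shuffle (occurrences 1F x) (occurrences 0F x))
  exchange 0F 1F 0F = refl
  exchange 0F 1F 1F = sym (+-identityʳ _)
  exchange 1F 0F 0F = sym (+-identityʳ _)
  exchange 1F 0F 1F = refl
  exchange 1F 1F 0F = trans (cong (_+ occurrences 1F x) (snoc 0F 0F)) (shuffle (occurrences 0F x) (occurrences 1F x))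
  exchange 1F 1F 1F = trans (+-identityʳ _) (trans (snoc 0F 1F) (+-identityʳ _))

-- Only a count of the remaining bits enters `charge`, so `σ` and `reverse` leave it unchanged.
charge-↭ : ∀ s b {x y} → x ↭ y → charge s b x ≡ charge s b y
charge-↭ s b x↭y = cong (if does (b ≟ s) then 0 else_) (occurrences-↭ s x↭y)

pairs-reverse : ∀ s x → pairs (opposite s) (reverse x) ≡ pairs s x
pairs-reverse s []      = refl
pairs-reverse s (b ∷ x) = begin
  pairs (opposite s) (reverse (b ∷ x))
    ≡⟨ cong (pairs (opposite s)) (unfold-reverse b x) ⟩
  pairs (opposite s) (reverse x ∷ʳ b)
    ≡⟨ pairs-∷ʳ s (reverse x) b ⟩
  charge s b (reverse x) + pairs (opposite s) (reverse x)
    ≡⟨ cong₂ _+_ (charge-↭ s b (↭-reverse x)) (pairs-reverse s x) ⟩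
  charge s b x + pairs s x ∎
  where open ≡-Reasoning

-- The permutation σ

-- The first `n` entries of an interleaving use at most `n` entries of either list. Both lengths are
-- bounded because the lists swap roles at each step.
take-interleave-++ : ∀ {A : Set} n (xs ys xs′ ys′ : List A) → n ≤ length xs → n ≤ length ys →
  take n (interleave (xs ++ xs′) (ys ++ ys′)) ≡ take n (interleave xs ys)
take-interleave-++ 0       xs       ys xs′ ys′ _         _    = refl
take-interleave-++ (suc n) (x ∷ xs) ys xs′ ys′ (s≤s n≤xs) n<ys =
  cong (x ∷_) (take-interleave-++ n ys xs ys′ xs′ (<⇒≤ n<ys) n≤xs)

-- After `a`, entries come alternately from the right and the left end of `xs`. The second copy of
-- `a`, at the end of `reverse (a ∷ xs)`, lies beyond the reach of `take`.
σ-∷ : ∀ {A : Set} (a : A) xs → σ (a ∷ xs) ≡ a ∷ σ (reverse xs)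
σ-∷ a xs = cong (a ∷_) (begin
  take n (interleave (reverse (a ∷ xs)) xs)
    ≡⟨ cong₂ (λ ys zs → take n (interleave ys zs)) (unfold-reverse a xs) (sym (++-identityʳ xs)) ⟩
  take n (interleave (reverse xs ++ a ∷ []) (xs ++ []))
    ≡⟨ take-interleave-++ n (reverse xs) xs (a ∷ []) [] (≤-reflexive (sym (length-reverse xs))) ≤-refl ⟩
  take n (interleave (reverse xs) xs)
    ≡⟨ cong₂ (λ m zs → take m (interleave (reverse xs) zs)) (sym (length-reverse xs)) (sym (reverse-involutive xs)) ⟩
  σ (reverse xs) ∎)
  where
  open ≡-Reasoning
  n = length xs

-- The recursion scheme matching `σ-∷`. It runs on the length, since `reverse xs` is not a subterm.
reverse-induction : ∀ {A : Set} (P : List A → Set) → P [] → (∀ a xs → P (reverse xs) → P (a ∷ xs)) →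
  ∀ xs → P xs
reverse-induction P P[] P∷ xs = go (length xs) xs refl
  where
  go : ∀ n xs → length xs ≡ n → P xs
  go n       []       _  = P[]
  go (suc n) (a ∷ xs) eq = P∷ a xs (go n (reverse xs) (trans (length-reverse xs) (suc-injective eq)))

σ-↭ : ∀ {A : Set} (xs : List A) → σ xs ↭ xs
σ-↭ = reverse-induction (λ xs → σ xs ↭ xs) ↭-refl λ a xs ih →
  subst (_↭ a ∷ xs) (sym (σ-∷ a xs)) (prep a (↭-trans ih (↭-reverse xs)))

σ-surjective : ∀ {A : Set} (c : List A) → ∃[ x ] c ≡ σ x
σ-surjective []      = [] , refl
σ-surjective (a ∷ c) with y , refl ← σ-surjective c =
  a ∷ reverse y , sym (trans (σ-∷ a (reverse y)) (cong (λ z → a ∷ σ z) (reverse-involutive y)))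

zigzag-σ : ∀ x s → zigzag s (σ x) ≡ pairs s x
-- The motive quantifies over `s` because the tail is measured with the opposite bit.
zigzag-σ = reverse-induction (λ x → ∀ s → zigzag s (σ x) ≡ pairs s x) (λ _ → refl) λ b x ih s → begin
  zigzag s (σ (b ∷ x))
    ≡⟨ cong (zigzag s) (σ-∷ b x) ⟩
  charge s b (σ (reverse x)) + zigzag (opposite s) (σ (reverse x))
    ≡⟨ cong₂ _+_ (charge-↭ s b (↭-trans (σ-↭ (reverse x)) (↭-reverse x))) (ih (opposite s)) ⟩
  charge s b x + pairs (opposite s) (reverse x)
    ≡⟨ cong₂ _+_ refl (pairs-reverse s x) ⟩
  charge s b x + pairs s x ∎
  where open ≡-Reasoning

zigzag-σ-inv : ∀ x → zigzag 0F (σ x) ≡ inv x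
zigzag-σ-inv x = trans (zigzag-σ x 0F) (sym (inv≡pairs x))

-- Insertions

-- Ins s d t c: inserting 01 or 10 into d gives c and raises zigzag s by t.
data Ins : Bit → BitSeq → ℕ → BitSeq → Set where
  low  : ∀ {s d}     → Ins s d 0 (s ∷ opposite s ∷ d)
  high : ∀ {s d}     → Ins s d (suc (length d)) (opposite s ∷ s ∷ d)
  same : ∀ {s d t c} → Ins (opposite s) d t c → Ins s (s ∷ d) t (s ∷ c)
  diff : ∀ {s d t c} → Ins (opposite s) d t c → Ins s (opposite s ∷ d) (suc t) (opposite s ∷ c)

dS-∷ : ∀ b {c d} → dS c d → dS (b ∷ c) (b ∷ d)
dS-∷ b (p , q , inj₁ refl , refl) = b ∷ p , q , inj₁ refl , refl
dS-∷ b (p , q , inj₂ refl , refl) = b ∷ p , q , inj₂ refl , refl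

Ins⇒dS : ∀ {s d t c} → Ins s d t c → dS c d
Ins⇒dS {0F} low  = [] , _ , inj₁ refl , refl
Ins⇒dS {1F} low  = [] , _ , inj₂ refl , refl
Ins⇒dS {0F} high = [] , _ , inj₂ refl , refl
Ins⇒dS {1F} high = [] , _ , inj₁ refl , refl
Ins⇒dS (same i)  = dS-∷ _ (Ins⇒dS i)
Ins⇒dS (diff i)  = dS-∷ _ (Ins⇒dS i)

Ins-∷ : ∀ s b {d c} → ∃[ t ] Ins (opposite s) d t c → ∃[ t ] Ins s (b ∷ d) t (b ∷ c)
Ins-∷ 0F 0F (t , i) = t     , same i
Ins-∷ 0F 1F (t , i) = suc t , diff i
Ins-∷ 1F 0F (t , i) = suc t , diff i
Ins-∷ 1F 1F (t , i) = t     , same i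

dS⇒Ins : ∀ s {c d} → dS c d → ∃[ t ] Ins s d t c
dS⇒Ins 0F ([]    , q , inj₁ refl , refl) = _ , low
dS⇒Ins 0F ([]    , q , inj₂ refl , refl) = _ , high
dS⇒Ins 1F ([]    , q , inj₁ refl , refl) = _ , high
dS⇒Ins 1F ([]    , q , inj₂ refl , refl) = _ , low
dS⇒Ins s  (b ∷ p , q , inj₁ refl , refl) = Ins-∷ s b (dS⇒Ins (opposite s) (p , q , inj₁ refl , refl))
dS⇒Ins s  (b ∷ p , q , inj₂ refl , refl) = Ins-∷ s b (dS⇒Ins (opposite s) (p , q , inj₂ refl , refl))

dS-↭ : ∀ {c d} → dS c d → c ↭ 0F ∷ 1F ∷ d
dS-↭ (p , q , inj₁ refl , refl) = shifts p (0F ∷ 1F ∷ [])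
dS-↭ (p , q , inj₂ refl , refl) = ↭-trans (shifts p (1F ∷ 0F ∷ [])) (swap 1F 0F ↭-refl)

dS-occurrences : ∀ s {c d} → dS c d → occurrences s c ≡ suc (occurrences s d)
dS-occurrences 0F dc = occurrences-↭ 0F (dS-↭ dc)
dS-occurrences 1F dc = occurrences-↭ 1F (dS-↭ dc)

-- Two inserted bits preserve the alternation, so `d` is still measured with `s`. In `low` neither
-- new bit is charged; in `high` they are charged for every bit of `d` and once for each other. A
-- prefixed bit costs nothing extra in `same`, and one more in `diff`, which sees the inserted `s`.
Ins-zigzag : ∀ s {d t c} → Ins s d t c → zigzag s c ≡ t + zigzag s d
Ins-zigzag 0F low  = refl
Ins-zigzag 1F low  = refl
Ins-zigzag 0F {d} high = cong suc (trans (sym (+-assoc (occurrences 0F d) _ _)) (cong (_+ zigzag 0F d) (occurrences-total 0F d)))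
Ins-zigzag 1F {d} high = cong suc (trans (sym (+-assoc (occurrences 1F d) _ _)) (cong (_+ zigzag 1F d) (occurrences-total 1F d)))
Ins-zigzag 0F (same i) = Ins-zigzag 1F i
Ins-zigzag 1F (same i) = Ins-zigzag 0F i
Ins-zigzag 0F {_ ∷ d} {suc t} (diff i) =
  trans (cong₂ _+_ (dS-occurrences 0F (Ins⇒dS i)) (Ins-zigzag 1F i)) (cong suc (x∙yz≈y∙xz +-commutativeSemigroup (occurrences 0F d) t (zigzag 1F d)))
Ins-zigzag 1F {_ ∷ d} {suc t} (diff i) =
  trans (cong₂ _+_ (dS-occurrences 1F (Ins⇒dS i)) (Ins-zigzag 0F i)) (cong suc (x∙yz≈y∙xz +-commutativeSemigroup (occurrences 1F d) t (zigzag 0F d)))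

Ins-bound : ∀ {s d t c} → Ins s d t c → t ≤ suc (length d)
Ins-bound low      = z≤n
Ins-bound high     = ≤-refl
Ins-bound (same i) = m≤n⇒m≤1+n (Ins-bound i)
Ins-bound (diff i) = s≤s (Ins-bound i)

-- Where `low` meets `same`, or `high` meets `diff`, inserting before or after the first bit gives
-- the same word, and the shorter insertion is again `low` or `high`. `high` never meets `same`,
-- whose value stays below the maximum by `Ins-bound`. Fixing `s` in each clause makes `opposite`
-- compute.
Ins-functional : ∀ s {d t c c′} → Ins s d t c → Ins s d t c′ → c ≡ c′
Ins-functional 0F low      low      = refl
Ins-functional 0F low      (same j) = cong (0F ∷_) (Ins-functional 1F low j)
Ins-functional 0F high     high     = refl
Ins-functional 0F high     (same j) = contradiction (Ins-bound j) (<-irrefl refl)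
Ins-functional 0F high     (diff j) = cong (1F ∷_) (Ins-functional 1F high j)
Ins-functional 0F (same i) low      = cong (0F ∷_) (Ins-functional 1F i low)
Ins-functional 0F (same i) high     = contradiction (Ins-bound i) (<-irrefl refl)
Ins-functional 0F (same i) (same j) = cong (0F ∷_) (Ins-functional 1F i j)
Ins-functional 0F (diff i) high     = cong (1F ∷_) (Ins-functional 1F i high)
Ins-functional 0F (diff i) (diff j) = cong (1F ∷_) (Ins-functional 1F i j)
Ins-functional 1F low      low      = refl
Ins-functional 1F low      (same j) = cong (1F ∷_) (Ins-functional 0F low j)
Ins-functional 1F high     high     = refl
Ins-functional 1F high     (same j) = contradiction (Ins-bound j) (<-irrefl refl)
Ins-functional 1F high     (diff j) = cong (0F ∷_) (Ins-functional 0F high j)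
Ins-functional 1F (same i) low      = cong (1F ∷_) (Ins-functional 0F i low)
Ins-functional 1F (same i) high     = contradiction (Ins-bound i) (<-irrefl refl)
Ins-functional 1F (same i) (same j) = cong (1F ∷_) (Ins-functional 0F i j)
Ins-functional 1F (diff i) high     = cong (0F ∷_) (Ins-functional 0F i high)
Ins-functional 1F (diff i) (diff j) = cong (0F ∷_) (Ins-functional 0F i j)

-- If `d` starts with `s`, then `same` supplies all values but the largest, which is `high`. If it
-- starts with the other bit, `diff` supplies all values but 0, which is `low`.
Ins-total : ∀ s d {t} → t ≤ suc (length d) → ∃[ c ] Ins s d t c
Ins-total s  []       {0}     _         = _ , low
Ins-total s  []       {suc _} (s≤s z≤n) = _ , high
Ins-total 0F (0F ∷ d) t≤ with m≤n⇒m<n∨m≡n t≤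
... | inj₁ t<   = _ , same (proj₂ (Ins-total 1F d (s≤s⁻¹ t<)))
... | inj₂ refl = _ , high
Ins-total 0F (1F ∷ d) {0}     _         = _ , low
Ins-total 0F (1F ∷ d) {suc _} (s≤s t≤)  = _ , diff (proj₂ (Ins-total 1F d t≤))
Ins-total 1F (0F ∷ d) {0}     _         = _ , low
Ins-total 1F (0F ∷ d) {suc _} (s≤s t≤)  = _ , diff (proj₂ (Ins-total 0F d t≤))
Ins-total 1F (1F ∷ d) t≤ with m≤n⇒m<n∨m≡n t≤
... | inj₁ t<   = _ , same (proj₂ (Ins-total 0F d (s≤s⁻¹ t<)))
... | inj₂ refl = _ , high

-- Residues

<⇒≢-mod : ∀ {n t t′} → t < t′ → t′ < n → ¬ ((+ t) ≡ (+ t′) [mod n ])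
<⇒≢-mod {n} {t} {t′} t<t′ t′<n n∣ =
  ℕ.>⇒∤ ⦃ >-nonZero (m<n⇒0<n∸m t<t′) ⦄ (≤-<-trans (m∸n≤m t′ t) t′<n)
    (subst (n ℕ.∣_) (trans (cong ∣_∣ (ℤₚ.m-n≡m⊖n t t′)) (ℤₚ.∣⊖∣-≤ (<⇒≤ t<t′))) (∣⇒∣ᵤ n∣))

mod-cancel : ∀ {n} k a i j → (+ (i + k)) ≡ a [mod n ] → (+ (j + k)) ≡ a [mod n ] → (+ i) ≡ (+ j) [mod n ]
mod-cancel {n} k a i j i+k≡a j+k≡a = subst (+ n ∣_) (cancel (+ i) (+ j) (+ k) a) (∣m∣n⇒∣m-n i+k≡a j+k≡a)
  where
  cancel : ∀ i j k a → ((i ℤ.+ k) - a) - ((j ℤ.+ k) - a) ≡ i - j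
  cancel = ℤ-Solver.solve-∀

mod-unique : ∀ {n} k a {i j} → i < n → j < n →
  (+ (i + k)) ≡ a [mod n ] → (+ (j + k)) ≡ a [mod n ] → i ≡ j
mod-unique k a {i} {j} i<n j<n i+k≡a j+k≡a with <-cmp i j
... | tri< i<j _ _ = contradiction (mod-cancel k a i j i+k≡a j+k≡a) (<⇒≢-mod i<j j<n)
... | tri≈ _ i≡j _ = i≡j
... | tri> _ _ j<i = contradiction (mod-cancel k a j i j+k≡a i+k≡a) (<⇒≢-mod j<i i<n)

-- The remainder of `a - k` serves as `t`, and the negated quotient witnesses the divisibility.
mod-representative : ∀ n k a → ∃[ t ] t ≤ n × (+ (t + k)) ≡ a [mod suc n ]
mod-representative n k a = t , s≤s⁻¹ (n%ℕd<d (a - + k) (suc n)) , divides (ℤ.- q) (begin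
  (+ t ℤ.+ + k) - a
    ≡⟨ rearrange (+ t) (+ k) a ⟩
  + t - (a - + k)
    ≡⟨ cong (+ t -_) (a≡a%ℕn+[a/ℕn]*n (a - + k) (suc n)) ⟩
  + t - (+ t ℤ.+ q ℤ.* + suc n)
    ≡⟨ cancel (+ t) q (+ suc n) ⟩
  ℤ.- q ℤ.* + suc n ∎)
  where
  open ≡-Reasoning
  t = (a - + k) %ℕ suc n
  q = (a - + k) /ℕ suc n
  rearrange : ∀ t k a → (t ℤ.+ k) - a ≡ t - (a - k)
  rearrange = ℤ-Solver.solve-∀
  cancel : ∀ t q n → t - (t ℤ.+ q ℤ.* n) ≡ ℤ.- q ℤ.* n
  cancel = ℤ-Solver.solve-∀

-- Membership in the code and its deletions

𝕐-↭ : ∀ {v h x y} → x ↭ y → x ∈ 𝕐 v h → y ∈ 𝕐 v h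
𝕐-↭ x↭y (len , zeros , ones) =
  trans (sym (↭-length x↭y)) len , trans (sym (occurrences-↭ 0F x↭y)) zeros , trans (sym (occurrences-↭ 1F x↭y)) ones

-- By `dS-↭`, a pair inserted anywhere may be moved to the front, so this case settles all
-- deletions.
𝕐-∷∷ : ∀ {v h} d → (0F ∷ 1F ∷ d) ∈ 𝕐 (suc v) (suc h) ⇔ d ∈ 𝕐 v h
𝕐-∷∷ {v} {h} d = mk⇔
  (λ (len , zeros , ones) → suc-injective (trans (suc-injective len) (+-suc v h)) , suc-injective zeros , suc-injective ones)
  (λ (len , zeros , ones) → cong suc (trans (cong suc len) (sym (+-suc v h))) , cong suc zeros , cong suc ones)

𝔹⇒𝕐 : ∀ {v h} a {c} → c ∈ 𝔹 v h a → c ∈ 𝕐 v h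
𝔹⇒𝕐 _ (x , (x∈𝕐 , _) , refl) = 𝕐-↭ (↭-sym (σ-↭ x)) x∈𝕐

𝔹⇒zigzag : ∀ {v h} a {c} → c ∈ 𝔹 v h a → (+ zigzag 0F c) ≡ a [mod v + h ]
𝔹⇒zigzag {v} {h} a (x , (_ , inv≡a) , refl) = subst (λ k → (+ k) ≡ a [mod v + h ]) (sym (zigzag-σ-inv x)) inv≡a

-- Surjectivity of `σ` supplies the preimage, so membership in `𝔹` becomes a condition on `c` alone.
𝕐∧zigzag⇒𝔹 : ∀ {v h} a {c} → c ∈ 𝕐 v h → (+ zigzag 0F c) ≡ a [mod v + h ] → c ∈ 𝔹 v h a
𝕐∧zigzag⇒𝔹 {v} {h} a {c} c∈𝕐 ≡a with x , refl ← σ-surjective c =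
  x , (𝕐-↭ (σ-↭ x) c∈𝕐 , subst (λ k → (+ k) ≡ a [mod v + h ]) (zigzag-σ-inv x) ≡a) , refl

dS-𝕐 : ∀ {v h c d} → dS c d → c ∈ 𝕐 (suc v) (suc h) → d ∈ 𝕐 v h
dS-𝕐 {d = d} dc c∈𝕐 = Equivalence.to (𝕐-∷∷ d) (𝕐-↭ (dS-↭ dc) c∈𝕐)

dS-disjoint : ∀ {v h} a {c c′ d} → c ∈ 𝔹 (suc v) (suc h) a → c′ ∈ 𝔹 (suc v) (suc h) a →
  dS c d → dS c′ d → c ≡ c′
dS-disjoint {v} {h} a {c} {c′} {d} c∈𝔹 c′∈𝔹 dc dc′
  with t , i ← dS⇒Ins 0F dc | t′ , i′ ← dS⇒Ins 0F dc′ =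
  Ins-functional 0F i (subst (λ t → Ins 0F d t c′) (sym t≡t′) i′)
  where
  -- The modulus equals the length of a codeword, `length d + 2`, just above the largest possible
  -- `t`.
  bound : ∀ {t c} → Ins 0F d t c → t < suc v + suc h
  bound {t} i = subst (t <_) (trans (sym (↭-length (dS-↭ dc))) (proj₁ (𝔹⇒𝕐 a c∈𝔹))) (s≤s (Ins-bound i))
  residue : ∀ {t c} → Ins 0F d t c → c ∈ 𝔹 (suc v) (suc h) a → (+ (t + zigzag 0F d)) ≡ a [mod suc v + suc h ]
  residue i c∈𝔹 = subst (λ k → (+ k) ≡ a [mod suc v + suc h ]) (Ins-zigzag 0F i) (𝔹⇒zigzag a c∈𝔹)
  t≡t′ : t ≡ t′
  t≡t′ = mod-unique (zigzag 0F d) a (bound i) (bound i′) (residue i c∈𝔹) (residue i′ c′∈𝔹)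

dS-covers : ∀ {v h} a {d} → d ∈ 𝕐 v h → ∃[ c ] c ∈ 𝔹 (suc v) (suc h) a × dS c d
dS-covers {v} {h} a {d} d∈𝕐
  -- The modulus is `suc (v + suc h)`, so the representative is at most `v + suc h`, which is
  -- `suc (length d)`: exactly the range of `Ins-total`.
  with t , t≤ , ≡a ← mod-representative (v + suc h) (zigzag 0F d) a
  with c , i ← Ins-total 0F d (subst (t ≤_) (trans (+-suc v h) (cong suc (sym (proj₁ d∈𝕐)))) t≤) =
  c , 𝕐∧zigzag⇒𝔹 a (𝕐-↭ (↭-sym (dS-↭ dc)) (Equivalence.from (𝕐-∷∷ d) d∈𝕐))
        (subst (λ k → (+ k) ≡ a [mod suc v + suc h ]) (sym (Ins-zigzag 0F i)) ≡a) , dc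
  where
  dc = Ins⇒dS i

theorem9p1 : (v h : ℕ) (a : ℤ) →
    (∀ c c′ → c ∈ 𝔹 (suc v) (suc h) a → c′ ∈ 𝔹 (suc v) (suc h) a → c ≢ c′ → Empty (dS c ∩ dS c′))
    × ⋃ (Σ BitSeq (𝔹 (suc v) (suc h) a)) (dS ∘ proj₁) ≐ 𝕐 v h
theorem9p1 v h a =
  (λ c c′ c∈𝔹 c′∈𝔹 c≢c′ d (dc , dc′) → c≢c′ (dS-disjoint a c∈𝔹 c′∈𝔹 dc dc′)) ,
  (λ ((c , c∈𝔹) , dc) → dS-𝕐 dc (𝔹⇒𝕐 a c∈𝔹)) ,
  (λ d∈𝕐 → let c , c∈𝔹 , dc = dS-covers a d∈𝕐 in (c , c∈𝔹) , dc)
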